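{- Let $m\ge2$. The map $\Phi_x(u):=u+\frac{x}{1-u}$ is invertible on the set of formal power series in $x$ with zero constant term. Its inverse is $$\Psi_x(v):=\frac{1+v-\sqrt{(1-v)^2+4x}}{2}$$ (square root with constant term $1$, so that $\Psi_x(v)$ has zero constant term), and $\Phi_x(\Psi_x(v))=v$. Consequently, with $U(x):=G_{m-1}(x)$, $$U(x)=G_{m-1}(x)=\Psi_x^{\,m-1}\bigl(G(x)\bigr),\qquad G(x)=\frac{1-\sqrt{1-4mx}}{2},$$ where $\Psi_x^{\,m-1}$ is the $(m-1)$-fold iterate. Moreover, the tail sums $H_k(x):=\sum_{j=k}^{m-1}G_j(x)$ are recovered from $U$ by $$H_{m-1}=U,\qquad H_k=\Phi_x(H_{k+1})\quad(k=m-2,\dots,0),$$ and the components by $G_k=H_k-H_{k+1}$ for $k=0,\dots,m-2$ and $G_{m-1}=H_{m-1}$.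
   Context: For an integer $m\ge2$ let $V_m=\{v_0<v_1<\cdots<v_{m-1}\}$ ($v_0=0$, $v_{m-1}=1$) be an $m$-element chain with Gödel implication $v_p\Rightarrow_G v_q=v_{m-1}$ if $p\le q$ and $v_p\Rightarrow_G v_q=v_q$ if $p>q$. For $n\ge1$, consider the $C_{n-1}$ full bracketings of $p_1\Rightarrow_G\cdots\Rightarrow_G p_n$ in $n$ distinct variables (full binary trees with $n$ ordered leaves), $C_k$ being the Catalan numbers. Let $g_n^{(j)}$ be the number of pairs (bracketing, valuation $\{p_1,\dots,p_n\}\to V_m$) for which the bracketed formula evaluates to $v_j$, and $g_n=\sum_{j=0}^{m-1}g_n^{(j)}=m^nC_{n-1}$. Put $G_j(x)=\sum_{n\ge1}g_n^{(j)}x^n$ and $G(x)=\sum_{n\ge1}g_nx^n=\sum_{j=0}^{m-1}G_j(x)$ (formal power series). -}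

module Defs where

open import Algebra.Bundles using (AbelianGroup; CommutativeRing; Semiring)
import Algebra.Construct.Pointwise as Pointwise
import Algebra.Properties.Monoid.Sum as MonoidSum
import Algebra.Properties.CommutativeSemigroup as CommutativeSemigroupProperties
import Algebra.Definitions.RawSemiring as RawSemiringDefinitions
open import Data.Empty using (⊥-elim)
open import Data.Fin.Base using (Fin; zero; suc; toℕ; fromℕ)
import Data.Fin.Properties as Fin
open import Data.List.Base
  using (List; []; _∷_; _++_; length; filter; map; concatMap; cartesianProduct;
         cartesianProductWith; allFin)
open import Data.List.Membership.Propositional using (_∈_)
open import Data.List.Membership.Propositional.Properties
  using (∈-map⁺; ∈-++⁺ʳ; ∈-allFin; ∈-concatMap⁺; ∈-cartesianProduct⁺;
         ∈-cartesianProductWith⁺; ∈-cartesianProductWith⁻; ∈-concatMap⁻)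
open import Data.List.Relation.Unary.All as All using ([]; _∷_)
import Data.List.Relation.Unary.All.Properties as All
open import Data.List.Relation.Unary.AllPairs as AllPairs using ([]; _∷_)
import Data.List.Relation.Unary.AllPairs.Properties as AllPairs
open import Data.List.Relation.Unary.Any as Any using (here; there)
open import Data.List.Relation.Binary.Disjoint.Propositional using (Disjoint)
open import Data.List.Relation.Unary.Unique.Propositional using (Unique)
import Data.List.Relation.Unary.Unique.Propositional.Properties as Unique
open import Data.Maybe.Base using (Maybe; just; nothing)
open import Data.Nat.Base as ℕ using (ℕ; zero; suc; _∸_; _≤_; _<_; z≤n; s≤s)
import Data.Nat.Properties as ℕ
open import Data.Product.Base using (Σ-syntax; _×_; _,_; proj₁; proj₂)
open import Data.Vec.Base using (Vec; []; _∷_; take; drop)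
open import Data.Vec.Properties using (∷-injective)
open import Function.Base using (_∘_; _on_)
open import Function.Endo.Propositional using () renaming (_^_ to iter)
open import Level using (_⊔_)
open import Relation.Binary.Core using (Rel)
open import Relation.Binary.PropositionalEquality.Core as ≡ using (_≡_; _≢_; refl)
open import Relation.Nullary.Decidable using (yes; no)

-- Gödel implication on the chain V_m = {v₀ < … < v_{m-1}}, encoded as
-- Fin m with v_j the element whose toℕ is j

infixr 5 _⇒ᴳ_
_⇒ᴳ_ : ∀ {m} → Fin m → Fin m → Fin m
_⇒ᴳ_ {suc l} p q with p Fin.≤? q
... | yes _ = fromℕ l
... | no  _ = q

-- Full binary trees with n ordered leaves; the k-th leaf is the variable p_k.

infixr 5 _⇒_
data Bracketing : ℕ → Set where
  leaf : Bracketing 1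
  _⇒_  : ∀ {a b} → Bracketing a → Bracketing b → Bracketing (a ℕ.+ b)

Valuation : ℕ → ℕ → Set
Valuation m n = Vec (Fin m) n

eval : ∀ {m n} → Bracketing n → Valuation m n → Fin m
eval leaf            (v ∷ []) = v
eval (_⇒_ {a} s t) vs       = eval s (take a vs) ⇒ᴳ eval t (drop a vs)

Split : ℕ → Set
Split n = Σ[ a ∈ ℕ ] Σ[ b ∈ ℕ ] a ℕ.+ b ≡ n

splits : ∀ n → List (Split n)
splits zero    = (0 , 0 , refl) ∷ []
splits (suc n) = (0 , suc n , refl)
               ∷ map (λ (a , b , eq) → suc a , b , ≡.cong suc eq) (splits n)

join : (∀ k → List (Bracketing k)) → ∀ {n} → Split n → List (Bracketing n)
join f (a , b , refl) = cartesianProductWith _⇒_ (f a) (f b)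

leaves : ∀ n → List (Bracketing n)
leaves 1 = leaf ∷ []
leaves _ = []

-- The bracketings with n leaves and at most d levels.
bracketings≤ : ℕ → ∀ n → List (Bracketing n)
bracketings≤ zero    n = []
bracketings≤ (suc d) n = leaves n ++ concatMap (join (bracketings≤ d)) (splits n)

-- A tree with n leaves has at most n levels.
bracketings : ∀ n → List (Bracketing n)
bracketings n = bracketings≤ n n

valuations : ∀ m n → List (Valuation m n)
valuations m zero    = [] ∷ []
valuations m (suc n) = cartesianProductWith _∷_ (allFin m) (valuations m n)

pairs : ∀ m n → List (Bracketing n × Valuation m n)
pairs m n = cartesianProduct (bracketings n) (valuations m n)

-- g m n j is g_n^{(j)} for j < m.
g : ℕ → ℕ → ℕ → ℕ
g m n j = length (filter (λ (t , v) → toℕ (eval t v) ℕ.≟ j) (pairs m n))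

gTotal : ℕ → ℕ → ℕ
gTotal m n = MonoidSum.sum ℕ.+-0-monoid {m} (λ j → g m n (toℕ j))

splits-complete : ∀ a b → (a , b , refl) ∈ splits (a ℕ.+ b)
splits-complete zero    zero    = here refl
splits-complete zero    (suc b) = here refl
splits-complete (suc a) b       = there (∈-map⁺ _ (splits-complete a b))

suc-split-injective : ∀ {n} {s s′ : Split n} →
  _≡_ {A = Split (suc n)} (suc (proj₁ s) , proj₁ (proj₂ s) , ≡.cong suc (proj₂ (proj₂ s)))
                          (suc (proj₁ s′) , proj₁ (proj₂ s′) , ≡.cong suc (proj₂ (proj₂ s′))) →
  s ≡ s′
suc-split-injective {s = a , b , p} {a′ , b′ , q} e
  with ≡.cong (ℕ.pred ∘ proj₁) e | ≡.cong (proj₁ ∘ proj₂) e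
... | refl | refl = ≡.cong (λ r → a , b , r) (ℕ.≡-irrelevant p q)

splits-unique : ∀ n → Unique (splits n)
splits-unique zero    = [] ∷ []
splits-unique (suc n) =
  All.map⁺ (All.universal (λ _ ()) (splits n)) ∷
  Unique.map⁺ suc-split-injective (splits-unique n)

1≤leaves : ∀ {n} → Bracketing n → 1 ≤ n
1≤leaves leaf    = s≤s z≤n
1≤leaves (s ⇒ t) = ℕ.≤-trans (1≤leaves s) (ℕ.m≤m+n _ _)

bracketings≤-complete : ∀ d {n} → n ≤ d → (t : Bracketing n) → t ∈ bracketings≤ d n
bracketings≤-complete (suc d) n≤d leaf = here refl
bracketings≤-complete zero n≤d t = ⊥-elim (ℕ.<-irrefl refl (ℕ.≤-trans (1≤leaves t) n≤d))
bracketings≤-complete (suc d) n≤d (_⇒_ {a} {b} s t) =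
  ∈-++⁺ʳ (leaves (a ℕ.+ b))
    (∈-concatMap⁺ (join (bracketings≤ d))
      (Any.map (λ { refl → ∈-cartesianProductWith⁺ _⇒_
                   (bracketings≤-complete d a≤d s) (bracketings≤-complete d b≤d t) })
               (splits-complete a b)))
  where
  a≤d : a ≤ d
  a≤d = ℕ.≤-pred (ℕ.≤-trans
    (ℕ.≤-trans (ℕ.≤-reflexive (ℕ.+-comm 1 a)) (ℕ.+-monoʳ-≤ a (1≤leaves t))) n≤d)
  b≤d : b ≤ d
  b≤d = ℕ.≤-pred (ℕ.≤-trans (ℕ.+-monoˡ-≤ b (1≤leaves s)) n≤d)

root : ∀ {n} → Bracketing n → Maybe (ℕ × ℕ)
root leaf              = nothing
root (_⇒_ {a} {b} _ _) = just (a , b)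

root-leaves : ∀ n {t} → t ∈ leaves n → root t ≡ nothing
root-leaves 1 (here refl) = refl

root-join : ∀ f {n} (s : Split n) {t} → t ∈ join f s → root t ≡ just (proj₁ s , proj₁ (proj₂ s))
root-join f (a , b , refl) t∈ with ∈-cartesianProductWith⁻ _⇒_ (f a) (f b) t∈
... | _ , _ , _ , _ , refl = refl

join-disjoint : ∀ f {n} {s s′ : Split n} → s ≢ s′ → Disjoint (join f s) (join f s′)
join-disjoint f {s = a , b , p} {a′ , b′ , q} s≢s′ (t∈ , t∈′)
  with ≡.trans (≡.sym (root-join f (a , b , p) t∈)) (root-join f (a′ , b′ , q) t∈′)
... | refl = s≢s′ (≡.cong (λ r → a , b , r) (ℕ.≡-irrelevant p q))

leaves-disjoint : ∀ f n → Disjoint (leaves n) (concatMap (join f) (splits n))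
leaves-disjoint f n (t∈ , t∈′) with Any.satisfied (∈-concatMap⁻ (join f) {xs = splits n} t∈′)
... | s , t∈s with ≡.trans (≡.sym (root-leaves n t∈)) (root-join f s t∈s)
... | ()

leaves-unique : ∀ n → Unique (leaves n)
leaves-unique 0             = []
leaves-unique 1             = [] ∷ []
leaves-unique (suc (suc _)) = []

⇒-injective : ∀ {a b} {s s′ : Bracketing a} {t t′ : Bracketing b} →
              _≡_ {A = Bracketing (a ℕ.+ b)} (s ⇒ t) (s′ ⇒ t′) → s ≡ s′ × t ≡ t′
⇒-injective refl = refl , refl

join-unique : ∀ f → (∀ k → Unique (f k)) → ∀ {n} (s : Split n) → Unique (join f s)
join-unique f u (a , b , refl) = Unique.cartesianProductWith⁺ _⇒_ ⇒-injective (u a) (u b)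

bracketings≤-unique : ∀ d n → Unique (bracketings≤ d n)
bracketings≤-unique zero    n = []
bracketings≤-unique (suc d) n = Unique.++⁺ (leaves-unique n)
  (Unique.concat⁺
    (All.map⁺ (All.universal (join-unique _ (bracketings≤-unique d)) (splits n)))
    (AllPairs.map⁺ (AllPairs.map (join-disjoint _) (splits-unique n))))
  (leaves-disjoint _ n)

valuations-complete : ∀ {m n} (v : Valuation m n) → v ∈ valuations m n
valuations-complete []      = here refl
valuations-complete (p ∷ v) =
  ∈-cartesianProductWith⁺ _∷_ (∈-allFin p) (valuations-complete v)

valuations-unique : ∀ m n → Unique (valuations m n)
valuations-unique m zero    = [] ∷ []
valuations-unique m (suc n) =
  Unique.cartesianProductWith⁺ _∷_ ∷-injective (Unique.allFin⁺ m) (valuations-unique m n)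

-- By pairs-complete and pairs-unique, g counts every pair exactly once.
pairs-complete : ∀ {m n} (p : Bracketing n × Valuation m n) → p ∈ pairs m n
pairs-complete {n = n} (t , v) =
  ∈-cartesianProduct⁺ (bracketings≤-complete n ℕ.≤-refl t) (valuations-complete v)

pairs-unique : ∀ m n → Unique (pairs m n)
pairs-unique m n = Unique.cartesianProduct⁺ (bracketings≤-unique n n) (valuations-unique m n)

module PowerSeries {c ℓ} (R : CommutativeRing c ℓ) where

  private
    module R where
      open CommutativeRing R public
      open MonoidSum +-monoid public using (sum)
      open import Relation.Binary.Reasoning.Setoid setoid public

  Series : Set c
  Series = ℕ → R.Carrier

  private
    open module Additive = AbelianGroup (Pointwise.abelianGroup ℕ R.+-abelianGroup)
      using (_≈_) renaming (_∙_ to infixl 6 _+_; ε to 0#; _⁻¹ to -_)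

  infixl 7 _*_
  infixr 8 _•_

  _•_ : R.Carrier → Series → Series
  (c • f) n = c R.* f n

  one : Series
  one zero    = R.1#
  one (suc _) = R.0#

  tail : Series → Series
  tail f n = f (suc n)

  -- (f * g)ₙ = Σ_{i≤n} fᵢ gₙ₋ᵢ
  _*_ : Series → Series → Series
  (f * g) n = R.sum {suc n} (λ i → f (toℕ i) R.* g (n ∸ toℕ i))

  private
    *-cong : ∀ {f f′ g g′} → f ≈ f′ → g ≈ g′ → f * g ≈ f′ * g′
    *-cong p q zero    = R.+-congʳ (R.*-cong (p 0) (q 0))
    *-cong p q (suc n) = R.+-cong (R.*-cong (p 0) (q (suc n))) (*-cong (p ∘ suc) q n)

    *-suc : ∀ f g n → (f * g) (suc n) R.≈ (f * tail g) n R.+ f (suc n) R.* g 0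
    *-suc f g zero    = R.trans (R.sym (R.+-assoc _ _ _)) (R.trans (R.+-identityʳ _)
                          (R.+-congʳ (R.sym (R.+-identityʳ _))))
    *-suc f g (suc n) = R.trans (R.+-congˡ (*-suc (tail f) g n)) (R.sym (R.+-assoc _ _ _))

    *-comm : ∀ f g → f * g ≈ g * f
    *-comm f g zero    = R.+-congʳ (R.*-comm _ _)
    *-comm f g (suc n) = R.begin
      f 0 R.* g (suc n) R.+ (tail f * g) n  R.≈⟨ R.+-cong (R.*-comm _ _) (*-comm (tail f) g n) ⟩
      g (suc n) R.* f 0 R.+ (g * tail f) n  R.≈⟨ R.+-comm _ _ ⟩
      (g * tail f) n R.+ g (suc n) R.* f 0  R.≈⟨ *-suc g f n ⟨
      (g * f) (suc n)                       R.∎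

    interchange : ∀ a b c d → (a R.+ b) R.+ (c R.+ d) R.≈ (a R.+ c) R.+ (b R.+ d)
    interchange = CommutativeSemigroupProperties.interchange R.+-commutativeSemigroup

    distribʳ : ∀ h f g → (f + g) * h ≈ f * h + g * h
    distribʳ h f g zero    = R.begin
      (f 0 R.+ g 0) R.* h 0 R.+ R.0#
        R.≈⟨ R.+-cong (R.distribʳ _ _ _) (R.sym (R.+-identityʳ R.0#)) ⟩
      (f 0 R.* h 0 R.+ g 0 R.* h 0) R.+ (R.0# R.+ R.0#)
        R.≈⟨ interchange _ _ _ _ ⟩
      (f 0 R.* h 0 R.+ R.0#) R.+ (g 0 R.* h 0 R.+ R.0#) R.∎
    distribʳ h f g (suc n) = R.trans
      (R.+-cong (R.distribʳ _ _ _) (distribʳ h (tail f) (tail g) n))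
      (interchange _ _ _ _)

    scale-*-assoc : ∀ c f g → (c • f) * g ≈ c • (f * g)
    scale-*-assoc c f g zero    = R.begin
      c R.* f 0 R.* g 0 R.+ R.0#           R.≈⟨ R.+-cong (R.*-assoc _ _ _) (R.sym (R.zeroʳ c)) ⟩
      c R.* (f 0 R.* g 0) R.+ c R.* R.0#   R.≈⟨ R.distribˡ _ _ _ ⟨
      c R.* (f 0 R.* g 0 R.+ R.0#)         R.∎
    scale-*-assoc c f g (suc n) = R.trans
      (R.+-cong (R.*-assoc _ _ _) (scale-*-assoc c (tail f) g n))
      (R.sym (R.distribˡ _ _ _))

    *-assoc : ∀ f g h → (f * g) * h ≈ f * (g * h)
    *-assoc f g h zero    = R.+-congʳ (R.begin
      (f 0 R.* g 0 R.+ R.0#) R.* h 0    R.≈⟨ R.*-congʳ (R.+-identityʳ _) ⟩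
      (f 0 R.* g 0) R.* h 0             R.≈⟨ R.*-assoc _ _ _ ⟩
      f 0 R.* (g 0 R.* h 0)             R.≈⟨ R.*-congˡ (R.+-identityʳ _) ⟨
      f 0 R.* (g 0 R.* h 0 R.+ R.0#)    R.∎)
    *-assoc f g h (suc n) = R.begin
      (f 0 R.* g 0 R.+ R.0#) R.* h (suc n) R.+ (((f 0 • tail g) + tail f * g) * h) n
        R.≈⟨ R.+-cong (R.*-congʳ (R.+-identityʳ _)) (distribʳ h (f 0 • tail g) (tail f * g) n) ⟩
      f 0 R.* g 0 R.* h (suc n) R.+
        (((f 0 • tail g) * h) n R.+ ((tail f * g) * h) n)
        R.≈⟨ R.+-cong (R.*-assoc _ _ _)
              (R.+-cong (scale-*-assoc (f 0) (tail g) h n) (*-assoc (tail f) g h n)) ⟩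
      f 0 R.* (g 0 R.* h (suc n)) R.+
        (f 0 R.* (tail g * h) n R.+ (tail f * (g * h)) n)
        R.≈⟨ R.+-assoc _ _ _ ⟨
      (f 0 R.* (g 0 R.* h (suc n)) R.+ f 0 R.* (tail g * h) n) R.+ (tail f * (g * h)) n
        R.≈⟨ R.+-congʳ (R.distribˡ _ _ _) ⟨
      f 0 R.* (g * h) (suc n) R.+ (tail f * (g * h)) n R.∎

    zeroˡ : ∀ f → 0# * f ≈ 0#
    zeroˡ f zero    = R.trans (R.+-identityʳ _) (R.zeroˡ _)
    zeroˡ f (suc n) = R.trans (R.+-cong (R.zeroˡ _) (zeroˡ f n)) (R.+-identityʳ _)

    *-identityˡ : ∀ f → one * f ≈ f
    *-identityˡ f zero    = R.trans (R.+-identityʳ _) (R.*-identityˡ _)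
    *-identityˡ f (suc n) =
      R.trans (R.+-cong (R.*-identityˡ _) (zeroˡ f n)) (R.+-identityʳ _)

  commutativeRing : CommutativeRing c ℓ
  commutativeRing = record
    { Carrier = Series
    ; _≈_ = _≈_ ; _+_ = _+_ ; _*_ = _*_ ; -_ = -_ ; 0# = 0# ; 1# = one
    ; isCommutativeRing = record
      { isRing = record
        { +-isAbelianGroup = Additive.isAbelianGroup
        ; *-cong     = *-cong
        ; *-assoc    = *-assoc
        ; *-identity = *-identityˡ , λ f → Additive.trans (*-comm f one) (*-identityˡ f)
        ; distrib    = (λ h f g → Additive.trans (*-comm h (f + g))
                          (Additive.trans (distribʳ h f g)
                            (Additive.∙-cong (*-comm f h) (*-comm g h))))
                     , distribʳ
        }
      ; *-comm = *-comm
      }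
    }

private
  module _ {c ℓ} (S : CommutativeRing c ℓ) where
    open CommutativeRing S
    open RawSemiringDefinitions (Semiring.rawSemiring semiring) using (_^_)
    open import Relation.Binary.Reasoning.Setoid setoid

    cancel : ∀ x y → x - y + y ≈ x
    cancel x y = begin
      x - y + y      ≈⟨ +-assoc _ _ _ ⟩
      x + (- y + y)  ≈⟨ +-congˡ (-‿inverseˡ y) ⟩
      x + 0#         ≈⟨ +-identityʳ x ⟩
      x              ∎

    reciprocal : ∀ x a′ a b → a ≈ 1# + x * a′ → b ≈ 1# - x * (a′ * b) → a * b ≈ 1#
    reciprocal x a′ a b a≈ b≈ = begin
      a * b                                  ≈⟨ *-congʳ a≈ ⟩
      (1# + x * a′) * b                      ≈⟨ distribʳ _ _ _ ⟩
      1# * b + x * a′ * b                    ≈⟨ +-cong (*-identityˡ b) (*-assoc _ _ _) ⟩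
      b + x * (a′ * b)                       ≈⟨ +-congʳ b≈ ⟩
      1# - x * (a′ * b) + x * (a′ * b)       ≈⟨ cancel _ _ ⟩
      1#                                     ∎

    square : ∀ x a′ a t s → a ≈ 1# + x * a′ → s ≈ 1# + x * t →
             t + t ≈ a′ - x * (t * t) → s ^ 2 ≈ a
    square x a′ a t s a≈ s≈ 2t≈ = begin
      s ^ 2                                       ≈⟨ *-congˡ (*-identityʳ s) ⟩
      s * s                                       ≈⟨ *-cong s≈ s≈ ⟩
      (1# + x * t) * (1# + x * t)                 ≈⟨ distribʳ _ _ _ ⟩
      1# * (1# + x * t) + x * t * (1# + x * t)    ≈⟨ +-cong (*-identityˡ _) (*-assoc _ _ _) ⟩
      1# + x * t + x * (t * (1# + x * t))         ≈⟨ +-assoc _ _ _ ⟩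
      1# + (x * t + x * (t * (1# + x * t)))       ≈⟨ +-congˡ (distribˡ _ _ _) ⟨
      1# + x * (t + t * (1# + x * t))             ≈⟨ +-congˡ (*-congˡ inner) ⟩
      1# + x * a′                                 ≈⟨ a≈ ⟨
      a                                           ∎
      where
      inner : t + t * (1# + x * t) ≈ a′
      inner = begin
        t + t * (1# + x * t)             ≈⟨ +-congˡ (distribˡ _ _ _) ⟩
        t + (t * 1# + t * (x * t))       ≈⟨ +-assoc _ _ _ ⟨
        t + t * 1# + t * (x * t)         ≈⟨ +-cong (+-congˡ (*-identityʳ t)) (trans (*-comm _ _) (*-assoc _ _ _)) ⟩
        t + t + x * (t * t)              ≈⟨ +-congʳ 2t≈ ⟩
        a′ - x * (t * t) + x * (t * t)   ≈⟨ cancel _ _ ⟩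
        a′                               ∎

IsHalf : ∀ {c ℓ} (R : CommutativeRing c ℓ) → CommutativeRing.Carrier R → Set ℓ
IsHalf R ½ = ½ + ½ ≈ 1#
  where open CommutativeRing R

-- ½ is needed both to divide by 2 and to extract square roots.
module GeneratingFunctions {c ℓ} (R : CommutativeRing c ℓ)
  (½ : CommutativeRing.Carrier R)
  (½+½≈1 : IsHalf R ½)
  where

  private module R where
      open CommutativeRing R public
      open RawSemiringDefinitions (Semiring.rawSemiring semiring) public using (_×_)

  open PowerSeries R public using (Series; _•_; tail; commutativeRing)
  open CommutativeRing commutativeRing public
    using (_≈_; _+_; _*_; _-_; 0#; 1#)
  private module S = CommutativeRing commutativeRing
  open RawSemiringDefinitions (Semiring.rawSemiring S.semiring) public
    using (_^_) renaming (_×_ to _·_)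
  open MonoidSum S.+-monoid public using (sum-syntax)

  shift : Series → Series
  shift f zero    = R.0#
  shift f (suc n) = f n

  X : Series
  X = shift 1#

  -- If the first n + 1 coefficients of F f only depend on the first n ones of f,
  -- this is the unique fixed point of F.
  fix : (Series → Series) → Series
  fix F n = iter Series F (suc n) 0# n

  -- The reciprocal of a series a with constant term 1: the solution of
  -- b = 1 - (a - 1) b.
  infix 9 _⁻¹
  _⁻¹ : Series → Series
  a ⁻¹ = fix (λ b → 1# - shift (tail a * b))

  infixl 7 _/_
  _/_ : Series → Series → Series
  f / a = f * a ⁻¹

  -- The square root, with constant term 1, of a series a with constant term 1:
  -- if a = 1 + x a′, it is 1 + x t for the solution of t = (a′ - x t²)/2.
  sqrt : Series → Series
  sqrt a = 1# + shift (fix (λ t → ½ • (tail a - shift (t * t))))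

  Series₀ : Set (c ⊔ ℓ)
  Series₀ = Σ[ u ∈ Series ] u 0 R.≈ R.0#

  _≈₀_ : Rel Series₀ ℓ
  _≈₀_ = _≈_ on proj₁

  -- Only meaningful on Series₀.
  Φ : Series → Series
  Φ u = u + X / (1# - u)

  -- Only meaningful on Series₀.
  Ψ : Series → Series
  Ψ v = ½ • (1# + v - sqrt ((1# - v) ^ 2 + 4 · X))

  Ψ^ : ℕ → Series → Series
  Ψ^ n = iter Series Ψ n

  Agree : ℕ → Rel Series ℓ
  Agree n f g = ∀ {i} → i < n → f i R.≈ g i

  Guarded : (Series → Series) → Set (c ⊔ ℓ)
  Guarded F = ∀ {n f g} → Agree n f g → Agree (suc n) (F f) (F g)

  iter-agree : ∀ {F} → Guarded F → ∀ {i j} → i ≤ j →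
               Agree i (iter Series F i 0#) (iter Series F j 0#)
  iter-agree F-guarded (s≤s i≤j) = F-guarded (iter-agree F-guarded i≤j)

  fix-unfold : ∀ {F} → Guarded F → fix F ≈ F (fix F)
  fix-unfold F-guarded n = F-guarded
    (λ i<n → R.sym (iter-agree F-guarded i<n (ℕ.n<1+n _))) (ℕ.n<1+n n)

  *-agree : ∀ {n f f′ g g′} → Agree n f f′ → Agree n g g′ → Agree n (f * g) (f′ * g′)
  *-agree p q {zero}  i<n       = R.+-congʳ (R.*-cong (p i<n) (q i<n))
  *-agree p q {suc i} (s≤s i<n) = R.+-cong
    (R.*-cong (p (s≤s z≤n)) (q (s≤s i<n)))
    (*-agree (p ∘ s≤s) (q ∘ ℕ.m<n⇒m<1+n) i<n)

  shift-agree : ∀ {n f g} → Agree n f g → Agree (suc n) (shift f) (shift g)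
  shift-agree p {zero}  _         = R.refl
  shift-agree p {suc i} (s≤s i<n) = p i<n

  X*≈shift : ∀ f → X * f ≈ shift f
  X*≈shift f zero    = R.trans (R.+-identityʳ _) (R.zeroˡ _)
  X*≈shift f (suc n) = R.trans (R.+-congʳ (R.zeroˡ _))
    (R.trans (R.+-identityˡ _) (S.*-identityˡ f n))

  1+shift-tail : ∀ {a} → a 0 R.≈ R.1# → 1# + shift (tail a) ≈ a
  1+shift-tail a₀ zero    = R.trans (R.+-identityʳ _) (R.sym a₀)
  1+shift-tail a₀ (suc n) = R.+-identityˡ _

  a≈1+X*tail : ∀ {a} → a 0 R.≈ R.1# → a ≈ 1# + X * tail a
  a≈1+X*tail {a} a₀ n = R.trans (R.sym (1+shift-tail {a} a₀ n))
    (R.+-congˡ (R.sym (X*≈shift (tail a) n)))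

  ⁻¹-inverse : ∀ {a} → a 0 R.≈ R.1# → a * a ⁻¹ ≈ 1#
  ⁻¹-inverse {a} a₀ = reciprocal commutativeRing X (tail a) a (a ⁻¹) (a≈1+X*tail {a} a₀)
    (λ n → R.trans (fix-unfold guarded n)
      (R.+-congˡ (R.-‿cong (R.sym (X*≈shift (tail a * a ⁻¹) n)))))
    where
    guarded : Guarded (λ b → 1# - shift (tail a * b))
    guarded {n} {f} {g} p i<n = R.+-congˡ (R.-‿cong
      (shift-agree (*-agree {n} {tail a} {tail a} {f} {g} (λ _ → R.refl) p) i<n))

  sqrt-constant : ∀ a → sqrt a 0 R.≈ R.1#
  sqrt-constant a = R.+-identityʳ _

  sqrt-square : ∀ {a} → a 0 R.≈ R.1# → sqrt a ^ 2 ≈ a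
  sqrt-square {a} a₀ = square commutativeRing X (tail a) a t (sqrt a) (a≈1+X*tail {a} a₀)
    (λ n → R.+-congˡ (R.sym (X*≈shift t n)))
    (λ n → R.trans (double n) (R.+-congˡ (R.-‿cong (R.sym (X*≈shift (t * t) n)))))
    where
    F : Series → Series
    F t = ½ • (tail a - shift (t * t))
    t = fix F
    guarded : Guarded F
    guarded {n} {f} {g} p i<n = R.*-congˡ (R.+-congˡ (R.-‿cong
      (shift-agree (*-agree {n} {f} {g} {f} {g} p p) i<n)))
    double : t + t ≈ tail a - shift (t * t)
    double n = R.trans (R.+-cong (fix-unfold guarded n) (fix-unfold guarded n))
      (R.trans (R.sym (R.distribʳ _ _ _))
        (R.trans (R.*-congʳ ½+½≈1) (R.*-identityˡ _)))

  Φ₀ : Series₀ → Series₀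
  Φ₀ (u , u₀) = Φ u , R.trans (R.+-cong u₀ (X*≈shift ((1# - u) ⁻¹) 0)) (R.+-identityʳ _)

  Ψ₀ : Series₀ → Series₀
  Ψ₀ (v , v₀) = Ψ v , R.trans (R.*-congˡ lemma) (R.zeroʳ ½)
    where
    lemma : (1# + v - sqrt ((1# - v) ^ 2 + 4 · X)) 0 R.≈ R.0#
    lemma = R.trans (R.+-cong (R.trans (R.+-congˡ v₀) (R.+-identityʳ _))
      (R.-‿cong (sqrt-constant ((1# - v) ^ 2 + 4 · X)))) (R.-‿inverseʳ _)

  -- Σ_{n≥1} aₙ xⁿ
  series≥1 : (ℕ → ℕ) → Series
  series≥1 a zero    = R.0#
  series≥1 a (suc n) = a (suc n) R.× R.1#

  G : ℕ → ℕ → Series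
  G m j = series≥1 (λ n → g m n j)

  U : ℕ → Series
  U m = G m (m ∸ 1)

  GTotal : ℕ → Series
  GTotal m = series≥1 (gTotal m)

  -- H m k = Σ_{j=k}^{m-1} G m j
  H : ℕ → ℕ → Series
  H m k = ∑[ i < m ∸ k ] G m (k ℕ.+ toℕ i)

{-# OPTIONS --safe #-}
module Submission where

-- For k < m - 1 an implication s ⇒ t has value v_k exactly when s > v_k and t = v_k,
-- so G_k = x + H_{k+1} G_k. Hence G_k = x / (1 - H_{k+1}) and
-- H_k = H_{k+1} + G_k = Φ H_{k+1}; dropping the condition on the value gives
-- G = m x + G², which is solved by completing the square. That Φ and Ψ are inverse
-- is the identity (p + 2d)² = p² + 4 (p + d) d with p = 1 - v and d = v - u: then
-- p + d = 1 - u, and p + 2d = 1 + v - 2u is the square root in Ψ.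

open import Defs
open import Algebra.Bundles using (CommutativeRing; Semiring)
import Algebra.Definitions.RawSemiring as RawSemiringDefinitions
import Algebra.Properties.AbelianGroup as AbelianGroupProperties
import Algebra.Properties.CommutativeSemigroup as CommutativeSemigroupProperties
import Algebra.Properties.Monoid.Sum as MonoidSum
import Algebra.Properties.Semiring.Mult as SemiringMult
import Algebra.Solver.Ring.NaturalCoefficients.Default as SemiringSolver
open import Data.Bool.Base using (Bool; true; false; if_then_else_)
open import Data.Fin.Base using (Fin; zero; suc; toℕ; fromℕ)
import Data.Fin.Properties as Fin
open import Data.List.Base
  using (List; []; _∷_; _++_; length; filter; map; concatMap; cartesianProductWith;
         allFin; tabulate; foldr)
open import Data.List.Properties using (concatMap-cong; cartesianProductWith-zeroʳ)
open import Data.Nat.Base as ℕ using (ℕ; zero; suc; _∸_; _≤_; _<_; z≤n; s≤s; _≡ᵇ_; _<ᵇ_)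
import Data.Nat.Properties as ℕ
open import Data.Product.Base using (_×_; _,_; proj₁; proj₂)
open import Data.Vec.Base using ([]; _∷_; take; drop)
open import Function.Base using (_∘_; id)
open import Function.Structures using (IsInverse)
import Relation.Binary.Construct.On as On
open import Relation.Binary.PropositionalEquality.Core as ≡ using (_≡_; _≢_)
open import Relation.Nullary.Decidable using (yes; no; does; dec-true; dec-false)
open import Relation.Unary using (Pred; Decidable)

-- Identities in commutative rings.

module RingIdentities {c ℓ} (S : CommutativeRing c ℓ) where
  open CommutativeRing S
  open RawSemiringDefinitions (Semiring.rawSemiring semiring)
    using (_^_) renaming (_×_ to _·_)
  open AbelianGroupProperties +-abelianGroup
    using (∙-cancelʳ; //-rightDividesˡ; //-rightDividesʳ)
  open import Relation.Binary.Reasoning.Setoid setoid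
  open SemiringSolver commutativeSemiring using (solve; _:+_; _:*_; con; _:=_)

  ^-congˡ : ∀ {x y} n → x ≈ y → x ^ n ≈ y ^ n
  ^-congˡ 0       x≈y = refl
  ^-congˡ (suc n) x≈y = *-cong x≈y (^-congˡ n x≈y)

  x+y≈z⇒x≈z-y : ∀ {x y z} → x + y ≈ z → x ≈ z - y
  x+y≈z⇒x≈z-y {x} {y} {z} eq = trans (sym (//-rightDividesʳ y x)) (+-congʳ eq)

  complete-square : ∀ p d → (p + (d + d)) ^ 2 ≈ p ^ 2 + 4 · ((p + d) * d)
  complete-square = solve 2 (λ p d →
    sq (p :+ (d :+ d)) := sq p :+ four ((p :+ d) :* d)) refl
    where
    -- These repeat the unfolding of `_^ 2` and `4 ·_`, trailing unit and zero included, so that the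
    -- solver's equation is the stated one by computation.
    sq   = λ x → x :* (x :* con 1)
    four = λ y → y :+ (y :+ (y :+ (y :+ con 0)))

  4·x≈[x+x]+[x+x] : ∀ x → 4 · x ≈ (x + x) + (x + x)
  4·x≈[x+x]+[x+x] = solve 1 (λ y → y :+ (y :+ (y :+ (y :+ con 0))) := (y :+ y) :+ (y :+ y)) refl

  -- This is (a - b)(a + b) = 0 without subtraction; `a + b` can be cancelled once it is known to be
  -- twice a unit.
  equal-squares : ∀ {a b} → a ^ 2 ≈ b ^ 2 → a * (a + b) ≈ b * (a + b)
  equal-squares {a} {b} a²≈b² = begin
    a * (a + b)    ≈⟨ solve 2 (λ a b → a :* (a :+ b) := a :* (a :* con 1) :+ b :* a) refl a b ⟩
    a ^ 2 + b * a  ≈⟨ +-congʳ a²≈b² ⟩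
    b ^ 2 + b * a  ≈⟨ solve 2 (λ a b → b :* (b :* con 1) :+ b :* a := b :* (a :+ b)) refl a b ⟩
    b * (a + b)    ∎

  *-cancelʳ-unit : ∀ {w w⁻¹ a b} → w * w⁻¹ ≈ 1# → a * w ≈ b * w → a ≈ b
  *-cancelʳ-unit {w} {w⁻¹} {a} {b} unit eq = begin
    a              ≈⟨ undo a ⟩
    a * w * w⁻¹    ≈⟨ *-congʳ eq ⟩
    b * w * w⁻¹    ≈⟨ undo b ⟨
    b              ∎
    where
    undo : ∀ a → a ≈ a * w * w⁻¹
    undo a = trans (sym (*-identityʳ a)) (trans (*-congˡ (sym unit)) (sym (*-assoc a w w⁻¹)))

  [x-y]+[y-z]≈x-z : ∀ x y z → (x - y) + (y - z) ≈ x - z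
  [x-y]+[y-z]≈x-z x y z = x+y≈z⇒x≈z-y (begin
    (x - y) + (y - z) + z    ≈⟨ +-assoc _ _ _ ⟩
    (x - y) + ((y - z) + z)  ≈⟨ +-congˡ (//-rightDividesˡ z y) ⟩
    (x - y) + y              ≈⟨ //-rightDividesˡ y x ⟩
    x                        ∎)

  -- For x = 1, y = v, z = u this reads p + 2d + 2u = 1 + v, which recovers u from the square root p
  -- + 2d.
  [x-y]+2[y-z]+2z≈x+y : ∀ x y z → (x - y) + ((y - z) + (y - z)) + (z + z) ≈ x + y
  [x-y]+2[y-z]+2z≈x+y x y z = begin
    (x - y) + ((y - z) + (y - z)) + (z + z)
      ≈⟨ solve 3 (λ p d z → p :+ (d :+ d) :+ (z :+ z) := (p :+ (d :+ z)) :+ (d :+ z)) refl _ _ _ ⟩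
    ((x - y) + ((y - z) + z)) + ((y - z) + z)
      ≈⟨ +-cong (+-congˡ (//-rightDividesˡ z y)) (//-rightDividesˡ z y) ⟩
    ((x - y) + y) + y
      ≈⟨ +-congʳ (//-rightDividesˡ y x) ⟩
    x + y ∎

  -- Instance of `complete-square` with p = 1 - 2x and d = x: then p + 2d = 1, and (p + d) d = x -
  -- x² = y.
  quadratic⇒square : ∀ {x y} → x ≈ y + x * x → (1# - (x + x)) ^ 2 + 4 · y ≈ 1#
  quadratic⇒square {x} {y} eq = begin
    p ^ 2 + 4 · y              ≈⟨ +-congˡ (4·-cong (sym [p+x]x≈y)) ⟩
    p ^ 2 + 4 · ((p + x) * x)  ≈⟨ complete-square p x ⟨
    (p + (x + x)) ^ 2          ≈⟨ ^-congˡ 2 p+2x≈1 ⟩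
    1# ^ 2                     ≈⟨ trans (*-identityˡ _) (*-identityˡ _) ⟩
    1#                         ∎
    where
    p = 1# - (x + x)
    p+2x≈1 : p + (x + x) ≈ 1#
    p+2x≈1 = //-rightDividesˡ (x + x) 1#
    4·-cong : ∀ {a b} → a ≈ b → 4 · a ≈ 4 · b
    4·-cong e = +-cong e (+-cong e (+-cong e (+-congʳ e)))
    [p+x]x≈y : (p + x) * x ≈ y
    [p+x]x≈y = ∙-cancelʳ (x * x) _ _ (begin
      (p + x) * x + x * x  ≈⟨ solve 2 (λ p x → (p :+ x) :* x :+ x :* x := (p :+ (x :+ x)) :* x) refl p x ⟩
      (p + (x + x)) * x    ≈⟨ *-congʳ p+2x≈1 ⟩
      1# * x               ≈⟨ *-identityˡ x ⟩
      x                    ≈⟨ eq ⟩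
      y + x * x            ∎)

  x≈y+zx⇒[1-z]x≈y : ∀ {x y z} → x ≈ y + z * x → (1# - z) * x ≈ y
  x≈y+zx⇒[1-z]x≈y {x} {y} {z} eq = ∙-cancelʳ (z * x) _ _ (begin
    (1# - z) * x + z * x  ≈⟨ distribʳ x (1# - z) z ⟨
    ((1# - z) + z) * x    ≈⟨ *-congʳ (//-rightDividesˡ z 1#) ⟩
    1# * x                ≈⟨ *-identityˡ x ⟩
    x                     ≈⟨ eq ⟩
    y + z * x             ∎)

-- The maps `Φ` and `Ψ` on power series, and quadratic equations.

module Inversion {c ℓ} (R : CommutativeRing c ℓ)
  (½ : CommutativeRing.Carrier R) (½+½≈1 : IsHalf R ½) where

  open GeneratingFunctions R ½ ½+½≈1
  private
    module R = CommutativeRing R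
    module S = CommutativeRing commutativeRing
  open RingIdentities commutativeRing
  open AbelianGroupProperties S.+-abelianGroup
    using (∙-cancelˡ; ∙-cancelʳ; //-rightDividesˡ; xyx⁻¹≈y)
  open SemiringMult S.semiring using (×-assocˡ; ×-congʳ)
  open import Relation.Binary.Reasoning.Setoid S.setoid

  ½•-cong : ∀ {f g} → f ≈ g → ½ • f ≈ ½ • g
  ½•-cong f≈g n = R.*-congˡ (f≈g n)

  double-½• : ∀ f → ½ • f + ½ • f ≈ f
  double-½• f n = R.trans (R.sym (R.distribʳ _ _ _))
    (R.trans (R.*-congʳ ½+½≈1) (R.*-identityˡ _))

  ½•-double : ∀ f → ½ • (f + f) ≈ f
  ½•-double f n = R.trans (R.distribˡ _ _ _) (double-½• f n)

  double-cancel : ∀ {f g} → f + f ≈ g + g → f ≈ g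
  double-cancel {f} {g} eq = begin
    f            ≈⟨ ½•-double f ⟨
    ½ • (f + f)  ≈⟨ ½•-cong eq ⟩
    ½ • (g + g)  ≈⟨ ½•-double g ⟩
    g            ∎

  4·-cancel : ∀ {f g} → 4 · f ≈ 4 · g → f ≈ g
  4·-cancel {f} {g} eq = double-cancel (double-cancel (begin
    (f + f) + (f + f)  ≈⟨ 4·x≈[x+x]+[x+x] f ⟨
    4 · f              ≈⟨ eq ⟩
    4 · g              ≈⟨ 4·x≈[x+x]+[x+x] g ⟩
    (g + g) + (g + g)  ∎))

  1-0≈1 : ∀ {x} → x R.≈ R.0# → R.1# R.- x R.≈ R.1#
  1-0≈1 x≈0 = R.trans (R.+-congˡ (R.trans (R.-‿cong x≈0) ε⁻¹≈ε)) (R.+-identityʳ _)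
    where open AbelianGroupProperties R.+-abelianGroup using (ε⁻¹≈ε)

  n·X-constant : ∀ n → (n · X) 0 R.≈ R.0#
  n·X-constant 0       = R.refl
  n·X-constant (suc n) = R.trans (R.+-identityˡ _) (n·X-constant n)

  ^2-constant : ∀ {a} → a 0 R.≈ R.1# → (a ^ 2) 0 R.≈ R.1#
  ^2-constant a₀ = R.trans (R.+-identityʳ _) (R.trans (R.*-cong a₀
    (R.trans (R.+-identityʳ _) (R.trans (R.*-identityʳ _) a₀))) (R.*-identityʳ _))

  -- The average `w` has constant term 1, so `⁻¹-inverse` applies to it, whereas `a + b` itself has
  -- constant term 2. Cancelling 2 and then `w` in `equal-squares` leaves a = b.
  square-injective : ∀ {a b} → a 0 R.≈ R.1# → b 0 R.≈ R.1# → a ^ 2 ≈ b ^ 2 → a ≈ b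
  square-injective {a} {b} a₀ b₀ a²≈b² =
    *-cancelʳ-unit (⁻¹-inverse {w} w₀) (double-cancel (begin
      a * w + a * w  ≈⟨ S.distribˡ a w w ⟨
      a * (w + w)    ≈⟨ S.*-congˡ {a} (double-½• (a + b)) ⟩
      a * (a + b)    ≈⟨ equal-squares a²≈b² ⟩
      b * (a + b)    ≈⟨ S.*-congˡ {b} (double-½• (a + b)) ⟨
      b * (w + w)    ≈⟨ S.distribˡ b w w ⟩
      b * w + b * w  ∎))
    where
    w : Series
    w = ½ • (a + b)
    w₀ : w 0 R.≈ R.1#
    w₀ = R.trans (R.*-congˡ (R.+-cong a₀ b₀)) (R.trans (R.distribˡ _ _ _)
      (R.trans (R.+-cong (R.*-identityʳ _) (R.*-identityʳ _)) ½+½≈1))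

  sqrt-unique : ∀ {a s} → a 0 R.≈ R.1# → s 0 R.≈ R.1# → s ^ 2 ≈ a → sqrt a ≈ s
  sqrt-unique {a} a₀ s₀ s²≈a = square-injective (sqrt-constant a) s₀
    (S.trans (sqrt-square a₀) (S.sym s²≈a))

  -- v = u + x / (1 - u) with the denominator cleared. As Φ u ≈ v and Ψ v ≈ u are both
  -- equivalent to u ↝ v, congruence and inverse laws follow formally.
  infix 4 _↝_
  _↝_ : Series → Series → Set ℓ
  u ↝ v = (1# - u) * (v - u) ≈ X

  ↝-resp : ∀ {u u′ v v′} → u ≈ u′ → v ≈ v′ → u ↝ v → u′ ↝ v′
  ↝-resp {u} {u′} {v} {v′} u≈ v≈ u↝v = S.trans
    (S.sym (S.*-cong {1# - u} {1# - u′} {v - u} {v′ - u′}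
      (S.+-congˡ (S.-‿cong u≈)) (S.+-cong v≈ (S.-‿cong u≈)))) u↝v

  -- The factor 1 - u has constant term 1 and can be cancelled.
  ↝-functional : ∀ {u v v′} → u 0 R.≈ R.0# → u ↝ v → u ↝ v′ → v ≈ v′
  ↝-functional {u} {v} {v′} u₀ u↝v u↝v′ = ∙-cancelʳ (S.- u) v v′
    (*-cancelʳ-unit (⁻¹-inverse {1# - u} (1-0≈1 u₀)) (begin
      (v - u) * (1# - u)   ≈⟨ S.*-comm _ _ ⟩
      (1# - u) * (v - u)   ≈⟨ S.trans u↝v (S.sym u↝v′) ⟩
      (1# - u) * (v′ - u)  ≈⟨ S.*-comm _ _ ⟩
      (v′ - u) * (1# - u)  ∎))

  ↝Φ : ∀ {u} → u 0 R.≈ R.0# → u ↝ Φ u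
  ↝Φ {u} u₀ = begin
    a * (Φ u - u)     ≈⟨ S.*-congˡ {a} (xyx⁻¹≈y u _) ⟩
    a * (X * a ⁻¹)    ≈⟨ S.*-congˡ {a} (S.*-comm X (a ⁻¹)) ⟩
    a * (a ⁻¹ * X)    ≈⟨ S.*-assoc a (a ⁻¹) X ⟨
    (a * a ⁻¹) * X    ≈⟨ S.*-congʳ {X} (⁻¹-inverse {a} (1-0≈1 u₀)) ⟩
    1# * X            ≈⟨ S.*-identityˡ X ⟩
    X                 ∎
    where
    a : Series
    a = 1# - u

  ↝⇒Φ : ∀ {u v} → u 0 R.≈ R.0# → u ↝ v → Φ u ≈ v
  ↝⇒Φ u₀ u↝v = ↝-functional u₀ (↝Φ u₀) u↝v

  discriminant : Series → Series
  discriminant v = (1# - v) ^ 2 + 4 · X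

  discriminant-constant : ∀ {v} → v 0 R.≈ R.0# → discriminant v 0 R.≈ R.1#
  discriminant-constant {v} v₀ = R.trans
    (R.+-cong (^2-constant {1# - v} (1-0≈1 v₀)) (n·X-constant 4)) (R.+-identityʳ _)

  -- The candidate `s` = p + 2d has constant term 1 and square `discriminant v`, so `sqrt-unique`
  -- identifies it with the root in `Ψ v`; what remains is 1 + v - s = 2u.
  ↝⇒Ψ : ∀ {u v} → u 0 R.≈ R.0# → v 0 R.≈ R.0# → u ↝ v → Ψ v ≈ u
  ↝⇒Ψ {u} {v} u₀ v₀ u↝v = begin
    ½ • (1# + v - sqrt (discriminant v))
      ≈⟨ ½•-cong (S.+-congˡ (S.-‿cong (sqrt-unique (discriminant-constant {v} v₀) s₀ s²≈))) ⟩
    ½ • (1# + v - s)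
      ≈⟨ ½•-cong (x+y≈z⇒x≈z-y (S.trans (S.+-comm (u + u) s) ([x-y]+2[y-z]+2z≈x+y 1# v u))) ⟨
    ½ • (u + u)
      ≈⟨ ½•-double u ⟩
    u ∎
    where
    d s : Series
    d = v - u
    s = (1# - v) + (d + d)
    d₀ : d 0 R.≈ R.0#
    d₀ = R.trans (R.+-cong v₀ (R.-‿cong u₀)) (R.-‿inverseʳ _)
    s₀ : s 0 R.≈ R.1#
    s₀ = R.trans (R.+-cong (1-0≈1 v₀) (R.trans (R.+-cong d₀ d₀) (R.+-identityʳ _)))
      (R.+-identityʳ _)
    s²≈ : s ^ 2 ≈ discriminant v
    s²≈ = S.trans (complete-square (1# - v) d)
      (S.+-congˡ (×-congʳ 4 (S.trans (S.*-congʳ {d} ([x-y]+[y-z]≈x-z 1# v u)) u↝v)))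

  -- The computation of `↝⇒Ψ` backwards: p² + 4 (p + d) d and p² + 4x both equal `s ^ 2`. Cancelling
  -- p² and then 4 gives (p + d) d = x.
  Ψ↝ : ∀ {v} → v 0 R.≈ R.0# → Ψ v ↝ v
  Ψ↝ {v} v₀ = S.trans (S.*-congʳ {d} (S.sym ([x-y]+[y-z]≈x-z 1# v u)))
    (4·-cancel (∙-cancelˡ ((1# - v) ^ 2) _ _ (begin
      (1# - v) ^ 2 + 4 · (((1# - v) + d) * d)  ≈⟨ complete-square (1# - v) d ⟨
      ((1# - v) + (d + d)) ^ 2                 ≈⟨ ^-congˡ 2 p+2d≈s ⟩
      s ^ 2                                    ≈⟨ sqrt-square (discriminant-constant {v} v₀) ⟩
      (1# - v) ^ 2 + 4 · X                     ∎)))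
    where
    u d s : Series
    u = Ψ v
    d = v - u
    s = sqrt (discriminant v)
    p+2d≈s : (1# - v) + (d + d) ≈ s
    p+2d≈s = ∙-cancelʳ (u + u) _ _ (begin
      (1# - v) + (d + d) + (u + u)  ≈⟨ [x-y]+2[y-z]+2z≈x+y 1# v u ⟩
      1# + v                        ≈⟨ //-rightDividesˡ s (1# + v) ⟨
      (1# + v - s) + s              ≈⟨ S.+-comm _ s ⟩
      s + (1# + v - s)              ≈⟨ S.+-congˡ (double-½• (1# + v - s)) ⟨
      s + (u + u)                   ∎)

  -- The relation `↝` is built from ring operations, which respect `≈`; passing through it avoids a
  -- congruence proof for `fix`, on which `⁻¹` and `sqrt` rest.
  Φ-cong : ∀ {u u′} → u 0 R.≈ R.0# → u′ 0 R.≈ R.0# → u ≈ u′ → Φ u ≈ Φ u′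
  Φ-cong u₀ u′₀ u≈u′ = ↝⇒Φ u₀ (↝-resp (S.sym u≈u′) S.refl (↝Φ u′₀))

  Ψ-cong : ∀ {v v′} → v 0 R.≈ R.0# → v′ 0 R.≈ R.0# → v ≈ v′ → Ψ v ≈ Ψ v′
  Ψ-cong {v} {v′} v₀ v′₀ v≈v′ = ↝⇒Ψ (proj₂ (Ψ₀ (v′ , v′₀))) v₀
    (↝-resp S.refl (S.sym v≈v′) (Ψ↝ v′₀))

  Φ₀-Ψ₀-inverse : IsInverse _≈₀_ _≈₀_ Φ₀ Ψ₀
  Φ₀-Ψ₀-inverse = record
    { isLeftInverse = record
      { isCongruent = record
        { cong           = λ {x} {y} → Φ-cong (proj₂ x) (proj₂ y)
        ; isEquivalence₁ = isEquivalence₀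
        ; isEquivalence₂ = isEquivalence₀
        }
      ; from-cong = λ {x} {y} → Ψ-cong (proj₂ x) (proj₂ y)
      ; inverseˡ  = λ {v} {u} u≈Ψv →
          ↝⇒Φ (proj₂ u) (↝-resp (S.sym u≈Ψv) S.refl (Ψ↝ (proj₂ v)))
      }
    ; inverseʳ = λ {u} {v} v≈Φu →
        ↝⇒Ψ (proj₂ u) (proj₂ v) (↝-resp S.refl (S.sym v≈Φu) (↝Φ (proj₂ u)))
    }
    where
    isEquivalence₀ = On.isEquivalence proj₁ S.isEquivalence

  -- Of the two roots of the quadratic, the zero constant term of `f` selects the one for which 1 -
  -- 2f has constant term 1 and so is the normalised square root.
  quadratic⇒sqrt : ∀ m {f} → f 0 R.≈ R.0# → f ≈ m · X + f * f →
                   f ≈ ½ • (1# - sqrt (1# - (4 ℕ.* m) · X))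
  quadratic⇒sqrt m {f} f₀ f≈ = S.sym (begin
    ½ • (1# - sqrt (1# - (4 ℕ.* m) · X))
      ≈⟨ ½•-cong (S.+-congˡ (S.-‿cong (sqrt-unique (1-0≈1 (n·X-constant (4 ℕ.* m))) p₀ p²≈))) ⟩
    ½ • (1# - p)
      ≈⟨ ½•-cong (x+y≈z⇒x≈z-y (S.trans (S.+-comm (f + f) p) (//-rightDividesˡ (f + f) 1#))) ⟨
    ½ • (f + f)
      ≈⟨ ½•-double f ⟩
    f ∎)
    where
    p : Series
    p = 1# - (f + f)
    p₀ : p 0 R.≈ R.1#
    p₀ = 1-0≈1 (R.trans (R.+-cong f₀ f₀) (R.+-identityʳ _))
    p²≈ : p ^ 2 ≈ 1# - (4 ℕ.* m) · X
    p²≈ = x+y≈z⇒x≈z-y (S.trans (S.+-congˡ (S.sym (×-assocˡ X 4 m))) (quadratic⇒square f≈))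

-- Recursion for the list of bracketings.

bracketings≤-0 : ∀ d → bracketings≤ d 0 ≡ []
bracketings≤-0 zero    = ≡.refl
bracketings≤-0 (suc d) rewrite bracketings≤-0 d = ≡.refl

-- A split with an empty part contributes no tree under either bound. In any other split both parts
-- are smaller than `n`, so the lowered bounds still cover them.
bracketings≤-stable : ∀ d d′ {n} → n ≤ d → n ≤ d′ → bracketings≤ d n ≡ bracketings≤ d′ n
bracketings≤-stable zero    d′      z≤n p′  = ≡.sym (bracketings≤-0 d′)
bracketings≤-stable (suc d) zero    p   z≤n = bracketings≤-0 (suc d)
bracketings≤-stable (suc d) (suc d′) {n} p p′ =
  ≡.cong (leaves n ++_) (concatMap-cong join-stable (splits n))
  where
  join-stable : ∀ (s : Split n) → join (bracketings≤ d) s ≡ join (bracketings≤ d′) s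
  join-stable (zero , b , ≡.refl)
    rewrite bracketings≤-0 d | bracketings≤-0 d′ = ≡.refl
  -- The left part may have `suc d` leaves here, beyond the induction hypothesis; the empty right
  -- factor settles the case.
  join-stable (suc a , zero , ≡.refl)
    rewrite bracketings≤-0 d | bracketings≤-0 d′ =
    ≡.trans (cartesianProductWith-zeroʳ _⇒_ (bracketings≤ d (suc a)))
      (≡.sym (cartesianProductWith-zeroʳ _⇒_ (bracketings≤ d′ (suc a))))
  join-stable (suc a , suc b , ≡.refl) = ≡.cong₂ (cartesianProductWith _⇒_)
    (bracketings≤-stable d d′ (left p) (left p′))
    (bracketings≤-stable d d′ (right p) (right p′))
    where
    left : ∀ {e} → suc a ℕ.+ suc b ≤ suc e → suc a ≤ e
    left q = ℕ.≤-pred (ℕ.≤-trans (s≤s (ℕ.m<m+n a (s≤s z≤n))) q)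
    right : ∀ {e} → suc a ℕ.+ suc b ≤ suc e → suc b ≤ e
    right q = ℕ.≤-trans (ℕ.m≤n+m (suc b) a) (ℕ.≤-pred q)

-- The Catalan recursion free of level bounds: by stability each part may be listed with its own
-- size as the bound.
bracketings-unfold : ∀ n →
  bracketings n ≡ leaves n ++ concatMap (join bracketings) (splits n)
bracketings-unfold n = ≡.trans
  (bracketings≤-stable n (suc n) ℕ.≤-refl (ℕ.n≤1+n n))
  (≡.cong (leaves n ++_) (concatMap-cong join-stable (splits n)))
  where
  join-stable : ∀ (s : Split n) → join (bracketings≤ n) s ≡ join bracketings s
  join-stable (a , b , ≡.refl) = ≡.cong₂ (cartesianProductWith _⇒_)
    (bracketings≤-stable (a ℕ.+ b) a (ℕ.m≤m+n a b) ℕ.≤-refl)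
    (bracketings≤-stable (a ℕ.+ b) b (ℕ.m≤n+m b a) ℕ.≤-refl)

-- Sums over lists and indicator functions.

module ListSum {c ℓ} (S : Semiring c ℓ) where
  open Semiring S hiding (zero)
  open SemiringMult S using () renaming (_×_ to _·_)
  open MonoidSum +-monoid using (sum)
  open CommutativeSemigroupProperties +-commutativeSemigroup using (interchange)
  open import Relation.Binary.Reasoning.Setoid setoid

  ∑ : ∀ {a} {A : Set a} → List A → (A → Carrier) → Carrier
  ∑ xs f = foldr (λ x → f x +_) 0# xs

  -- Indicators take values in the semiring, so that a conjunction of conditions becomes a product
  -- and a disjoint union becomes a sum.
  χ : Bool → Carrier
  χ b = if b then 1# else 0#

  module _ {a} {A : Set a} where

    ∑-cong : ∀ {f g} (xs : List A) → (∀ x → f x ≈ g x) → ∑ xs f ≈ ∑ xs g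
    ∑-cong []       eq = refl
    ∑-cong (x ∷ xs) eq = +-cong (eq x) (∑-cong xs eq)

    ∑-zero : ∀ (xs : List A) → ∑ xs (λ _ → 0#) ≈ 0#
    ∑-zero []       = refl
    ∑-zero (x ∷ xs) = trans (+-identityˡ _) (∑-zero xs)

    ∑-distrib-+ : ∀ f g (xs : List A) → ∑ xs (λ x → f x + g x) ≈ ∑ xs f + ∑ xs g
    ∑-distrib-+ f g []       = sym (+-identityˡ 0#)
    ∑-distrib-+ f g (x ∷ xs) =
      trans (+-congˡ (∑-distrib-+ f g xs)) (interchange _ _ _ _)

    *-distribʳ-∑ : ∀ f y (xs : List A) → ∑ xs f * y ≈ ∑ xs (λ x → f x * y)
    *-distribʳ-∑ f y []       = zeroˡ y
    *-distribʳ-∑ f y (x ∷ xs) = trans (distribʳ y _ _) (+-congˡ (*-distribʳ-∑ f y xs))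

    *-distribˡ-∑ : ∀ f y (xs : List A) → y * ∑ xs f ≈ ∑ xs (λ x → y * f x)
    *-distribˡ-∑ f y []       = zeroʳ y
    *-distribˡ-∑ f y (x ∷ xs) = trans (distribˡ y _ _) (+-congˡ (*-distribˡ-∑ f y xs))

    ∑-++ : ∀ f (xs ys : List A) → ∑ (xs ++ ys) f ≈ ∑ xs f + ∑ ys f
    ∑-++ f []       ys = sym (+-identityˡ _)
    ∑-++ f (x ∷ xs) ys = trans (+-congˡ (∑-++ f xs ys)) (sym (+-assoc _ _ _))

    ∑-tabulate : ∀ f {n} (h : Fin n → A) → ∑ (tabulate h) f ≡ sum (f ∘ h)
    ∑-tabulate f {zero}  h = ≡.refl
    ∑-tabulate f {suc n} h = ≡.cong (f (h zero) +_) (∑-tabulate f (h ∘ suc))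

    length-filter : ∀ {p} {P : Pred A p} (P? : Decidable P) xs →
                    length (filter P? xs) · 1# ≈ ∑ xs (λ x → χ (does (P? x)))
    length-filter P? []       = refl
    length-filter P? (x ∷ xs) with does (P? x)
    ... | true  = +-congˡ (length-filter P? xs)
    ... | false = trans (length-filter P? xs) (sym (+-identityˡ _))

  ∑-map : ∀ {a b} {A : Set a} {B : Set b} f (h : A → B) xs → ∑ (map h xs) f ≡ ∑ xs (f ∘ h)
  ∑-map f h []       = ≡.refl
  ∑-map f h (x ∷ xs) = ≡.cong (f (h x) +_) (∑-map f h xs)

  ∑-concatMap : ∀ {a b} {A : Set a} {B : Set b} f (h : A → List B) xs →
                ∑ (concatMap h xs) f ≈ ∑ xs (λ x → ∑ (h x) f)
  ∑-concatMap f h []       = refl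
  ∑-concatMap f h (x ∷ xs) = trans (∑-++ f (h x) _) (+-congˡ (∑-concatMap f h xs))

  module _ {a b} {A : Set a} {B : Set b} where

    ∑-cartesianProductWith : ∀ {c} {C : Set c} f (h : A → B → C) xs ys →
      ∑ (cartesianProductWith h xs ys) f ≈ ∑ xs (λ x → ∑ ys (λ y → f (h x y)))
    ∑-cartesianProductWith f h []       ys = refl
    ∑-cartesianProductWith f h (x ∷ xs) ys = trans (∑-++ f (map (h x) ys) _)
      (+-cong (reflexive (∑-map f (h x) ys)) (∑-cartesianProductWith f h xs ys))

    ∑-* : ∀ f g (xs : List A) (ys : List B) →
          ∑ xs (λ x → ∑ ys (λ y → f x * g y)) ≈ ∑ xs f * ∑ ys g
    ∑-* f g xs ys = sym (trans (*-distribʳ-∑ f (∑ ys g) xs)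
      (∑-cong xs (λ x → *-distribˡ-∑ g (f x) ys)))

  -- A single variable takes the value v_k under exactly one valuation; this is the summand x in the
  -- equation for G_k.
  sum-χ≡ : ∀ {n k} → k < n → sum {n} (λ i → χ (toℕ i ≡ᵇ k)) ≈ 1#
  sum-χ≡ {suc n} {zero}  _         = trans (+-congˡ (MonoidSum.sum-replicate-zero +-monoid n))
    (+-identityʳ 1#)
  sum-χ≡ {suc n} {suc k} (s≤s k<n) = trans (+-identityˡ _) (sum-χ≡ k<n)

  -- Here `k <ᵇ suc n` encodes k ≤ n, which splits into n = k and n > k.
  χ≡+χ> : ∀ k n → χ (n ≡ᵇ k) + χ (k <ᵇ n) ≈ χ (k <ᵇ suc n)
  χ≡+χ> zero    zero    = +-identityʳ 1#
  χ≡+χ> zero    (suc n) = +-identityˡ 1#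
  χ≡+χ> (suc k) zero    = +-identityʳ 0#
  χ≡+χ> (suc k) (suc n) = χ≡+χ> k n

  -- If p ≤ q, the left side vanishes because the implication is the top element and k < l, and the
  -- right side vanishes because k < p and q = k would contradict p ≤ q. If p > q, the value is q,
  -- and q = k already forces k < p.
  χ-⇒ᴳ : ∀ {l k} → k < l → (p q : Fin (suc l)) →
         χ (toℕ (p ⇒ᴳ q) ≡ᵇ k) ≈ χ (k <ᵇ toℕ p) * χ (toℕ q ≡ᵇ k)
  χ-⇒ᴳ {l} {k} k<l p q = by-cases
    where
    top≢k : toℕ (fromℕ l) ≢ k
    top≢k e = ℕ.<⇒≢ k<l (≡.trans (≡.sym e) (Fin.toℕ-fromℕ l))
    by-cases : χ (toℕ (p ⇒ᴳ q) ≡ᵇ k) ≈ χ (k <ᵇ toℕ p) * χ (toℕ q ≡ᵇ k)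
    by-cases with p Fin.≤? q | toℕ q ℕ.≟ k
    ... | yes p≤q | yes ≡.refl
      rewrite dec-false (toℕ (fromℕ l) ℕ.≟ k) top≢k
            | dec-false (k ℕ.<? toℕ p) (ℕ.≤⇒≯ p≤q)  = sym (zeroˡ _)
    ... | yes p≤q | no q≢k
      rewrite dec-false (toℕ (fromℕ l) ℕ.≟ k) top≢k
            | dec-false (toℕ q ℕ.≟ k) q≢k           = sym (zeroʳ _)
    ... | no p≰q  | yes ≡.refl
      rewrite dec-true (k ℕ.<? toℕ p) (ℕ.≰⇒> p≰q)   = sym (*-identityˡ _)
    ... | no p≰q  | no q≢k
      rewrite dec-false (toℕ q ℕ.≟ k) q≢k           = sym (zeroʳ _)

-- Generating functions of weighted pairs.

module Counting {c ℓ} (R : CommutativeRing c ℓ)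
  (½ : CommutativeRing.Carrier R) (½+½≈1 : IsHalf R ½) (m : ℕ) where

  open GeneratingFunctions R ½ ½+½≈1
  private
    module R = CommutativeRing R
    module S = CommutativeRing commutativeRing
    module RM = SemiringMult R.semiring
    module RS = MonoidSum R.+-monoid
    module SS = MonoidSum S.+-monoid
  open ListSum R.semiring
  open import Relation.Binary.Reasoning.Setoid R.setoid

  -- Valuations of the two subformulas are chosen independently; the form with `take` and `drop` is
  -- the one that `eval` produces on `s ⇒ t`.
  ∑-valuations : ∀ a {b} (h : Valuation m a → Valuation m b → R.Carrier) →
    ∑ (valuations m (a ℕ.+ b)) (λ v → h (take a v) (drop a v)) R.≈
    ∑ (valuations m a) (λ u → ∑ (valuations m b) (h u))
  ∑-valuations zero        h = R.sym (R.+-identityʳ _)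
  ∑-valuations (suc a) {b} h = begin
    ∑ (valuations m (suc a ℕ.+ b)) (λ v → h (take (suc a) v) (drop (suc a) v))
      ≈⟨ ∑-cartesianProductWith _ _∷_ (allFin m) (valuations m (a ℕ.+ b)) ⟩
    ∑ (allFin m) (λ p → ∑ (valuations m (a ℕ.+ b)) (λ v → h (p ∷ take a v) (drop a v)))
      ≈⟨ ∑-cong (allFin m) (λ p → ∑-valuations a (h ∘ (p ∷_))) ⟩
    ∑ (allFin m) (λ p → ∑ (valuations m a) (λ u → ∑ (valuations m b) (h (p ∷ u))))
      ≈⟨ ∑-cartesianProductWith _ _∷_ (allFin m) (valuations m a) ⟨
    ∑ (valuations m (suc a)) (λ u → ∑ (valuations m b) (h u)) ∎

  treeSum : (Fin m → R.Carrier) → ∀ {n} → Bracketing n → R.Carrier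
  treeSum φ {n} t = ∑ (valuations m n) (λ v → φ (eval t v))

  -- Generating function of all pairs weighted by `φ` of their value. With `φ` arbitrary, one
  -- recursion serves the components, the tail sums and the total.
  valueSum : (Fin m → R.Carrier) → Series
  valueSum φ n = ∑ (bracketings n) (treeSum φ)

  valueSum-cong : ∀ {φ ψ} → (∀ p → φ p R.≈ ψ p) → valueSum φ ≈ valueSum ψ
  valueSum-cong eq n =
    ∑-cong (bracketings n) (λ t → ∑-cong (valuations m n) (λ v → eq (eval t v)))

  valueSum-+ : ∀ φ ψ → valueSum (λ p → φ p R.+ ψ p) ≈ valueSum φ + valueSum ψ
  valueSum-+ φ ψ n = R.trans
    (∑-cong (bracketings n) (λ t → ∑-distrib-+ _ _ (valuations m n)))
    (∑-distrib-+ (treeSum φ) (treeSum ψ) (bracketings n))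

  valueSum-zero : valueSum (λ _ → R.0#) ≈ 0#
  valueSum-zero n = R.trans (∑-cong (bracketings n) (λ t → ∑-zero (valuations m n)))
    (∑-zero (bracketings n))

  -- The list `splits n` runs through the index pairs in the order of the Cauchy product, so both
  -- sums unfold alike.
  ∑-splits : ∀ f g n → ∑ (splits n) (λ s → f (proj₁ s) R.* g (proj₁ (proj₂ s))) R.≈ (f * g) n
  ∑-splits f g zero    = R.refl
  ∑-splits f g (suc n) = R.+-congˡ
    (R.trans (R.reflexive (∑-map _ _ (splits n))) (∑-splits (tail f) g n))

  ∑-leaves : ∀ φ n → ∑ (leaves n) (treeSum φ) R.≈ (∑ (allFin m) φ • X) n
  ∑-leaves φ 0             = R.sym (R.zeroʳ _)
  ∑-leaves φ 1             = begin
    treeSum φ leaf R.+ R.0#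
      ≈⟨ R.+-identityʳ _ ⟩
    treeSum φ leaf
      ≈⟨ ∑-cartesianProductWith _ _∷_ (allFin m) _ ⟩
    ∑ (allFin m) (λ p → φ p R.+ R.0#)
      ≈⟨ ∑-cong (allFin m) (λ p → R.+-identityʳ (φ p)) ⟩
    ∑ (allFin m) φ
      ≈⟨ R.*-identityʳ _ ⟨
    ∑ (allFin m) φ R.* R.1# ∎
  ∑-leaves φ (suc (suc n)) = R.sym (R.zeroʳ _)

  module _ {φ f g : Fin m → R.Carrier} (φ-⇒ : ∀ p q → φ (p ⇒ᴳ q) R.≈ f p R.* g q) where

    treeSum-⇒ : ∀ {a b} (s : Bracketing a) (t : Bracketing b) →
                treeSum φ (s ⇒ t) R.≈ treeSum f s R.* treeSum g t
    treeSum-⇒ {a} {b} s t = begin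
      treeSum φ (s ⇒ t)
        ≈⟨ ∑-valuations a (λ u w → φ (eval s u ⇒ᴳ eval t w)) ⟩
      ∑ (valuations m a) (λ u → ∑ (valuations m b) (λ w → φ (eval s u ⇒ᴳ eval t w)))
        ≈⟨ ∑-cong (valuations m a) (λ u → ∑-cong (valuations m b) (λ w → φ-⇒ _ _)) ⟩
      ∑ (valuations m a) (λ u → ∑ (valuations m b) (λ w → f (eval s u) R.* g (eval t w)))
        ≈⟨ ∑-* _ _ (valuations m a) (valuations m b) ⟩
      treeSum f s R.* treeSum g t ∎

    ∑-join : ∀ {n} (s : Split n) → ∑ (join bracketings s) (treeSum φ) R.≈
             valueSum f (proj₁ s) R.* valueSum g (proj₁ (proj₂ s))
    ∑-join (a , b , ≡.refl) = begin
      ∑ (join bracketings (a , b , ≡.refl)) (treeSum φ)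
        ≈⟨ ∑-cartesianProductWith (treeSum φ) _⇒_ (bracketings a) (bracketings b) ⟩
      ∑ (bracketings a) (λ s → ∑ (bracketings b) (λ t → treeSum φ (s ⇒ t)))
        ≈⟨ ∑-cong (bracketings a) (λ s → ∑-cong (bracketings b) (λ t → treeSum-⇒ s t)) ⟩
      ∑ (bracketings a) (λ s → ∑ (bracketings b) (λ t → treeSum f s R.* treeSum g t))
        ≈⟨ ∑-* (treeSum f) (treeSum g) (bracketings a) (bracketings b) ⟩
      valueSum f a R.* valueSum g b ∎

    -- A formula is either a variable, contributing the total weight of the chain times x, or an
    -- implication, where `φ-⇒` separates the weights of the two independent sides and the sum over
    -- splits is a Cauchy product.
    valueSum-⇒ : valueSum φ ≈ ∑ (allFin m) φ • X + valueSum f * valueSum g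
    valueSum-⇒ n = begin
      ∑ (bracketings n) (treeSum φ)
        ≡⟨ ≡.cong (λ ts → ∑ ts (treeSum φ)) (bracketings-unfold n) ⟩
      ∑ (leaves n ++ concatMap (join bracketings) (splits n)) (treeSum φ)
        ≈⟨ ∑-++ (treeSum φ) (leaves n) _ ⟩
      ∑ (leaves n) (treeSum φ) R.+ ∑ (concatMap (join bracketings) (splits n)) (treeSum φ)
        ≈⟨ R.+-cong (∑-leaves φ n) (∑-concatMap (treeSum φ) (join bracketings) (splits n)) ⟩
      (∑ (allFin m) φ • X) n R.+ ∑ (splits n) (λ s → ∑ (join bracketings s) (treeSum φ))
        ≈⟨ R.+-congˡ (∑-cong (splits n) ∑-join) ⟩
      (∑ (allFin m) φ • X) n R.+
        ∑ (splits n) (λ s → valueSum f (proj₁ s) R.* valueSum g (proj₁ (proj₂ s)))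
        ≈⟨ R.+-congˡ (∑-splits (valueSum f) (valueSum g) n) ⟩
      (∑ (allFin m) φ • X + valueSum f * valueSum g) n ∎

  -- With `suc` on the right of `<ᵇ`, `atLeast (suc k) p` computes to `χ (k <ᵇ toℕ p)`, the form in
  -- `χ≡+χ>` and `χ-⇒ᴳ`.
  equals atLeast : ℕ → Fin m → R.Carrier
  equals  k p = χ (toℕ p ≡ᵇ k)
  atLeast k p = χ (k <ᵇ suc (toℕ p))

  G≈valueSum : ∀ k → G m k ≈ valueSum (equals k)
  -- The list `bracketings 0` computes to `[]`, in accordance with the constant term of `series≥1`.
  G≈valueSum k zero    = R.refl
  G≈valueSum k (suc n) = R.trans (length-filter _ (pairs m (suc n)))
    (∑-cartesianProductWith _ _,_ (bracketings (suc n)) (valuations m (suc n)))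

  valueSum-atLeast : ∀ k → valueSum (equals k) + valueSum (atLeast (suc k)) ≈ valueSum (atLeast k)
  valueSum-atLeast k = S.trans (S.sym (valueSum-+ (equals k) (atLeast (suc k))))
    (valueSum-cong (λ p → χ≡+χ> k (toℕ p)))

  valueSum-atLeast-m : valueSum (atLeast m) ≈ 0#
  valueSum-atLeast-m = S.trans (valueSum-cong (λ p → R.reflexive
      (≡.cong χ (dec-false (m ℕ.<? suc (toℕ p)) (ℕ.≤⇒≯ (Fin.toℕ<n p))))))
    valueSum-zero

  -- The number `r` replaces the `m ∸ k` of `H`, so that induction can split off the summand
  -- `G m k`; it starts at k = m, where no value is left.
  tailSum≈valueSum : ∀ r k → k ℕ.+ r ≡ m →
                     SS.sum {r} (λ i → G m (k ℕ.+ toℕ i)) ≈ valueSum (atLeast k)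
  tailSum≈valueSum zero k k+0≡m
    rewrite ≡.trans (≡.sym (ℕ.+-identityʳ k)) k+0≡m = S.sym valueSum-atLeast-m
  tailSum≈valueSum (suc r) k k+r≡m = S.trans
    (S.+-cong
      (S.trans (S.reflexive (≡.cong (G m) (ℕ.+-identityʳ k))) (G≈valueSum k))
      (S.trans
        (S.reflexive (SS.sum-cong-≗ {r} (λ i → ≡.cong (G m) (ℕ.+-suc k (toℕ i)))))
        (tailSum≈valueSum r (suc k) (≡.trans (≡.sym (ℕ.+-suc k r)) k+r≡m))))
    (valueSum-atLeast k)

  H≈valueSum : ∀ {k} → k ≤ m → H m k ≈ valueSum (atLeast k)
  H≈valueSum {k} k≤m = tailSum≈valueSum (m ∸ k) k (ℕ.m+[n∸m]≡n k≤m)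

  H-constant : ∀ {k} → k ≤ m → H m k 0 R.≈ R.0#
  H-constant k≤m = H≈valueSum k≤m 0

  H-step : ∀ {k} → k < m → H m k ≈ G m k + H m (suc k)
  H-step {k} k<m = S.trans (H≈valueSum (ℕ.<⇒≤ k<m)) (S.trans (S.sym (valueSum-atLeast k))
    (S.sym (S.+-cong (G≈valueSum k) (H≈valueSum k<m))))

  H-last : H m m ≈ 0#
  H-last = S.trans (H≈valueSum ℕ.≤-refl) valueSum-atLeast-m

  sum-coefficient : ∀ {r} (f : Fin r → Series) n → SS.sum f n ≡ RS.sum (λ i → f i n)
  sum-coefficient {zero}  f n = ≡.refl
  sum-coefficient {suc r} f n = ≡.cong (f zero n R.+_) (sum-coefficient (f ∘ suc) n)

  sum-×1 : ∀ {r} (f : Fin r → ℕ) →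
           MonoidSum.sum ℕ.+-0-monoid f RM.× R.1# R.≈ RS.sum (λ i → f i RM.× R.1#)
  sum-×1 {zero}  f = R.refl
  sum-×1 {suc r} f = R.trans (RM.×-homo-+ R.1# (f zero) _) (R.+-congˡ (sum-×1 (f ∘ suc)))

  GTotal≈H : GTotal m ≈ H m 0
  GTotal≈H zero    = R.sym (H-constant z≤n)
  GTotal≈H (suc n) = R.trans (sum-×1 {m} (λ j → g m (suc n) (toℕ j)))
    (R.reflexive (≡.sym (sum-coefficient {m} (λ j → G m (toℕ j)) (suc n))))

  ×1•≈· : ∀ n f → (n RM.× R.1#) • f ≈ n · f
  ×1•≈· zero    f i = R.zeroˡ (f i)
  ×1•≈· (suc n) f i = R.trans (R.distribʳ (f i) R.1# _)
    (R.+-cong (R.*-identityˡ (f i)) (×1•≈· n f i))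

  -- The constant weight 1 factors as 1 · 1 over every implication, and a variable contributes m.
  GTotal-quadratic : GTotal m ≈ m · X + GTotal m * GTotal m
  GTotal-quadratic = S.trans GTotal≈one (S.trans
    (valueSum-⇒ (λ _ _ → R.sym (R.*-identityˡ R.1#)))
    (S.+-cong
      (S.trans (λ n → R.*-congʳ (R.trans (R.reflexive (∑-tabulate (λ _ → R.1#) {m} id)) (RS.sum-replicate m)))
        (×1•≈· m X))
      (S.sym (S.*-cong GTotal≈one GTotal≈one))))
    where
    GTotal≈one : GTotal m ≈ valueSum (λ _ → R.1#)
    -- The weight `atLeast 0` computes to the constant 1.
    GTotal≈one = S.trans GTotal≈H (H≈valueSum z≤n)

  1•≈ : ∀ {a} → a R.≈ R.1# → ∀ f → a • f ≈ f
  1•≈ a≈1 f n = R.trans (R.*-congʳ a≈1) (R.*-identityˡ (f n))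

-- Recurrences for the components and the tail sums, with `l` the index of the top element.

module Recurrences {c ℓ} (R : CommutativeRing c ℓ)
  (½ : CommutativeRing.Carrier R) (½+½≈1 : IsHalf R ½) (l : ℕ) where

  open GeneratingFunctions R ½ ½+½≈1
  private
    module R = CommutativeRing R
    module S = CommutativeRing commutativeRing
  open RingIdentities commutativeRing
  open Inversion R ½ ½+½≈1
  open ListSum R.semiring
  open Counting R ½ ½+½≈1 (suc l)

  -- The first factor in `χ-⇒ᴳ` is `atLeast (suc k)`, the weight of H_{k+1}.
  G-recurrence : ∀ {k} → k < l → G (suc l) k ≈ X + H (suc l) (suc k) * G (suc l) k
  G-recurrence {k} k<l = S.trans (G≈valueSum k) (S.trans
    (valueSum-⇒ {equals k} {atLeast (suc k)} {equals k} (χ-⇒ᴳ k<l))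
    (S.+-cong
      (1•≈ (R.trans (R.reflexive (∑-tabulate (equals k) {suc l} id)) (sum-χ≡ (ℕ.m<n⇒m<1+n k<l))) X)
      (S.sym (S.*-cong (H≈valueSum (s≤s (ℕ.<⇒≤ k<l))) (G≈valueSum k)))))

  G≈H-H : ∀ {k} → k < suc l → G (suc l) k ≈ H (suc l) k - H (suc l) (suc k)
  G≈H-H k<m = x+y≈z⇒x≈z-y (S.sym (H-step k<m))

  -- Substituting G_k = H_k - H_{k+1} into (1 - H_{k+1}) G_k = x gives this relation, from which
  -- both the `Φ` and the `Ψ` form are read off.
  H↝H : ∀ {k} → k < l → H (suc l) (suc k) ↝ H (suc l) k
  H↝H {k} k<l = S.trans
    (S.*-congˡ {1# - H (suc l) (suc k)} (S.sym (G≈H-H (ℕ.m<n⇒m<1+n k<l))))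
    (x≈y+zx⇒[1-z]x≈y {z = H (suc l) (suc k)} (G-recurrence k<l))

  H≈ΦH : ∀ {k} → k < l → H (suc l) k ≈ Φ (H (suc l) (suc k))
  H≈ΦH k<l = S.sym (↝⇒Φ (H-constant (ℕ.m<n⇒m<1+n k<l)) (H↝H k<l))

  -- Upward induction from H_0 = G: each application of `Ψ` raises the index by one.
  H≈Ψ^ : ∀ {k} → k ≤ l → H (suc l) k ≈ Ψ^ k (GTotal (suc l))
  H≈Ψ^ {zero}  _   = S.sym GTotal≈H
  H≈Ψ^ {suc k} k<l = S.trans
    (S.sym (↝⇒Ψ (H-constant (s≤s (ℕ.<⇒≤ k<l))) H₀ (H↝H k<l)))
    -- The iterate inherits its zero constant term from H_k through the induction hypothesis.
    (Ψ-cong H₀ (R.trans (R.sym (ih 0)) H₀) ih)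
    where
    ih = H≈Ψ^ (ℕ.<⇒≤ k<l)
    H₀ = H-constant (ℕ.m≤n⇒m≤1+n (ℕ.<⇒≤ k<l))

  H-l≈G : H (suc l) l ≈ G (suc l) l
  H-l≈G = S.trans (H-step ℕ.≤-refl) (S.trans (S.+-congˡ H-last) (S.+-identityʳ _))

proposition6 : ∀ {c ℓ} (R : CommutativeRing c ℓ) (½ : CommutativeRing.Carrier R)
    (½+½≈1 : IsHalf R ½) →
    let open GeneratingFunctions R ½ ½+½≈1 in
    (m : ℕ) → 2 ≤ m →
    IsInverse _≈₀_ _≈₀_ Φ₀ Ψ₀
    × ((v : Series₀) → Φ₀ (Ψ₀ v) ≈₀ v)
    × U m ≈ Ψ^ (m ∸ 1) (GTotal m)
    × GTotal m ≈ ½ • (1# - sqrt (1# - (4 ℕ.* m) · X))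
    × H m (m ∸ 1) ≈ U m
    × (∀ k → suc k < m → H m k ≈ Φ (H m (suc k)))
    × (∀ k → suc k < m → G m k ≈ H m k - H m (suc k))
    × G m (m ∸ 1) ≈ H m (m ∸ 1)
proposition6 R ½ ½+½≈1 m@(suc l) _ =
    Φ₀-Ψ₀-inverse
  , IsInverse.strictlyInverseˡ Φ₀-Ψ₀-inverse
  , S.trans (S.sym H-l≈G) (H≈Ψ^ ℕ.≤-refl)
  , quadratic⇒sqrt m R.refl GTotal-quadratic
  , H-l≈G
  , (λ { k (s≤s k<l) → H≈ΦH k<l })
  , (λ { k k<l → G≈H-H (ℕ.<⇒≤ k<l) })
  , S.sym H-l≈G
  where
  module R = CommutativeRing R
  module S = CommutativeRing (PowerSeries.commutativeRing R)
  open Inversion R ½ ½+½≈1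
  open Counting R ½ ½+½≈1 m
  open Recurrences R ½ ½+½≈1 l
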